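{- Let $m>1$ be an integer such that $3 \nmid m$ and $2 \,\|\, m$ (that is, $m \equiv 2 \pmod 4$). Then the elliptic curve over $\mathbf{Q}$ given by \[ E'_m \colon y^2 = x^3 + x - m^6 \] has rank at least $2$.
   Context: The rank of an elliptic curve $E/\mathbf{Q}$ is the integer $r\ge 0$ such that $E(\mathbf{Q}) \simeq \mathbf{Z}^r \oplus T$ with $T$ a finite abelian group (Mordell-Weil theorem). -}

module Defs where

open import Algebra.Bundles using (AbelianGroup; RawGroup)
import Algebra.Construct.DirectProduct as DirectProduct
import Algebra.Construct.Pointwise as Pointwise
open import Algebra.Morphism.Structures using (module GroupMorphisms)
open import Data.Fin.Base using (Fin)
open import Data.Integer.Base as ℤ using (ℤ)
import Data.Integer.Properties as ℤₚ
open import Data.Nat.Base using (ℕ)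
open import Data.Rational.Base
open import Data.Rational.Properties
open import Data.Rational.Solver using (module +-*-Solver)
open import Data.Sum.Base using (inj₁; inj₂)
open import Function.Bundles using (Inverse)
open import Level using (0ℓ)
open import Relation.Binary.PropositionalEquality
open import Relation.Nullary using (yes; no)

2ℚ 3ℚ 4ℚ 27ℚ : ℚ
2ℚ  = ℤ.+ 2 / 1
3ℚ  = ℤ.+ 3 / 1
4ℚ  = ℤ.+ 4 / 1
27ℚ = ℤ.+ 27 / 1

-- Since char ℚ ≠ 2, 3, every elliptic curve over ℚ has a model of this form.
record EllipticCurve : Set where
  field
    a b         : ℚ
    nonsingular : 4ℚ * (a * a * a) + 27ℚ * (b * b) ≢ 0ℚ

  cubic : ℚ → ℚ
  cubic x = x * x * x + a * x + b

  -- The equation is an irrelevant field, so that points with equal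
  -- coordinates are propositionally equal.  It can be recovered with
  -- `recompute`, as equality on ℚ is decidable.
  data Point : Set where
    ∞      : Point
    affine : (x y : ℚ) → .(y * y ≡ cubic x) → Point

open +-*-Solver

x-y≡0⇒x≡y : ∀ x y → x - y ≡ 0ℚ → x ≡ y
x-y≡0⇒x≡y x y eq = begin
  x           ≡⟨ solve 2 (λ x y → x := (x :- y) :+ y) refl x y ⟩
  (x - y) + y ≡⟨ cong (_+ y) eq ⟩
  0ℚ + y      ≡⟨ +-identityˡ y ⟩
  y           ∎
  where open ≡-Reasoning

x+y≡0⇒x≡-y : ∀ x y → x + y ≡ 0ℚ → x ≡ - y
x+y≡0⇒x≡-y x y eq = x-y≡0⇒x≡y x (- y)
  (trans (solve 2 (λ x y → x :- (:- y) := x :+ y) refl x y) eq)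

x≡y⇒x-y≡0 : ∀ {x y} → x ≡ y → x - y ≡ 0ℚ
x≡y⇒x-y≡0 {x} refl = +-inverseʳ x

*-cancelʳ-NZ : ∀ d .{{_ : NonZero d}} x y → x * d ≡ y * d → x ≡ y
*-cancelʳ-NZ d x y eq = begin
  x                ≡⟨ step x ⟨
  x * d * (1/ d)   ≡⟨ cong (_* (1/ d)) eq ⟩
  y * d * (1/ d)   ≡⟨ step y ⟩
  y                ∎
  where
  open ≡-Reasoning
  step : ∀ z → z * d * (1/ d) ≡ z
  step z = trans (*-assoc z d (1/ d))
    (trans (cong (z *_) (*-inverseʳ d)) (*-identityʳ z))

÷-* : ∀ n d .{{_ : NonZero d}} → (n ÷ d) * d ≡ n
÷-* n d = trans (*-assoc n (1/ d) d)
  (trans (cong (n *_) (*-inverseˡ d)) (*-identityʳ n))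

zero*  : ∀ {x} y → x ≡ 0ℚ → x * y ≡ 0ℚ
zero* y refl = *-zeroˡ y

x*y≡0 : ∀ x y → y ≢ 0ℚ → x * y ≡ 0ℚ → x ≡ 0ℚ
x*y≡0 x y y≢0 eq = *-cancelʳ-NZ y x 0ℚ (trans eq (sym (*-zeroˡ y)))
  where instance _ = ≢-nonZero y≢0

module GroupLaw (E : EllipticCurve) where
  open EllipticCurve E

  infix 8 ⊖_
  ⊖_ : Point → Point
  ⊖ ∞              = ∞
  ⊖ (affine x y e) = affine x (- y)
    (trans (solve 1 (λ y → (:- y) :* (:- y) := y :* y) refl y) e)

  -- A line y = y₁ + s (x - x₁) meets the curve in the points with
  -- abscissae x₁, x₂ and s² - x₁ - x₂ (with multiplicity) when
  -- (x₁ , y₁) is on the curve and the slope s satisfies this equation.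
  Slope : (s x₁ y₁ x₂ : ℚ) → Set
  Slope s x₁ y₁ x₂ =
    2ℚ * y₁ * s + s * s * (x₂ - x₁) ≡ x₁ * x₁ + x₁ * x₂ + x₂ * x₂ + a

  thirdX : (s x₁ x₂ : ℚ) → ℚ
  thirdX s x₁ x₂ = s * s - x₁ - x₂

  thirdY : (s x₁ y₁ x₂ : ℚ) → ℚ
  thirdY s x₁ y₁ x₂ = s * (x₁ - thirdX s x₁ x₂) - y₁

  onCurve : ∀ s x₁ y₁ x₂ → y₁ * y₁ ≡ cubic x₁ → Slope s x₁ y₁ x₂ →
            thirdY s x₁ y₁ x₂ * thirdY s x₁ y₁ x₂ ≡ cubic (thirdX s x₁ x₂)
  onCurve s x₁ y₁ x₂ e sl = x-y≡0⇒x≡y _ _ (begin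
    thirdY s x₁ y₁ x₂ * thirdY s x₁ y₁ x₂ - cubic (thirdX s x₁ x₂)
      ≡⟨ solve 6 (λ s x₁ y₁ x₂ a b →
           let X = s :* s :- x₁ :- x₂
               Y = s :* (x₁ :- X) :- y₁
           in Y :* Y :- (X :* X :* X :+ a :* X :+ b)
              := (y₁ :* y₁ :- (x₁ :* x₁ :* x₁ :+ a :* x₁ :+ b))
                 :+ (con 2ℚ :* y₁ :* s :+ s :* s :* (x₂ :- x₁)
                     :- (x₁ :* x₁ :+ x₁ :* x₂ :+ x₂ :* x₂ :+ a)) :* (X :- x₁))
           refl s x₁ y₁ x₂ a b ⟩
    (y₁ * y₁ - cubic x₁)
      + (2ℚ * y₁ * s + s * s * (x₂ - x₁)
          - (x₁ * x₁ + x₁ * x₂ + x₂ * x₂ + a)) * (thirdX s x₁ x₂ - x₁)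
      ≡⟨ cong₂ _+_ (x≡y⇒x-y≡0 e) (zero* _ (x≡y⇒x-y≡0 sl)) ⟩
    0ℚ ∎)
    where open ≡-Reasoning

  x₂-x₁≢0 : ∀ {x₁ x₂} → x₁ ≢ x₂ → x₂ - x₁ ≢ 0ℚ
  x₂-x₁≢0 ne eq = ne (sym (x-y≡0⇒x≡y _ _ eq))

  -- Two points with the same abscissa are equal or opposite.
  sameAbscissa⇒y₁≡y₂ : ∀ {x₁ y₁ x₂ y₂} → y₁ * y₁ ≡ cubic x₁ → y₂ * y₂ ≡ cubic x₂ →
              x₁ ≡ x₂ → y₁ ≢ - y₂ → y₁ ≡ y₂
  sameAbscissa⇒y₁≡y₂ {x₁} {y₁} {x₂} {y₂} e₁ e₂ refl ne = x-y≡0⇒x≡y y₁ y₂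
    (x*y≡0 (y₁ - y₂) (y₁ + y₂) (λ eq → ne (x+y≡0⇒x≡-y y₁ y₂ eq))
      (trans (solve 2 (λ u v → (u :- v) :* (u :+ v) := u :* u :- v :* v) refl y₁ y₂)
             (x≡y⇒x-y≡0 (trans e₁ (sym e₂)))))

  2y≢0 : ∀ {x₁ y₁ x₂ y₂} → y₁ * y₁ ≡ cubic x₁ → y₂ * y₂ ≡ cubic x₂ →
         x₁ ≡ x₂ → y₁ ≢ - y₂ → 2ℚ * y₁ ≢ 0ℚ
  2y≢0 {x₁} {y₁} {x₂} {y₂} e₁ e₂ x≡ ne eq = ne (x+y≡0⇒x≡-y y₁ y₂ (begin
    y₁ + y₂  ≡⟨ cong (y₁ +_) (sameAbscissa⇒y₁≡y₂ {x₁} {y₁} {x₂} e₁ e₂ x≡ ne) ⟨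
    y₁ + y₁  ≡⟨ solve 1 (λ y → y :+ y := con 2ℚ :* y) refl y₁ ⟩
    2ℚ * y₁  ≡⟨ eq ⟩
    0ℚ       ∎))
    where open ≡-Reasoning

  chordSlope : ∀ s {x₁ y₁ x₂ y₂} → y₁ * y₁ ≡ cubic x₁ → y₂ * y₂ ≡ cubic x₂ →
               x₁ ≢ x₂ → s * (x₂ - x₁) ≡ y₂ - y₁ → Slope s x₁ y₁ x₂
  chordSlope s {x₁} {y₁} {x₂} {y₂} e₁ e₂ ne eq = x-y≡0⇒x≡y _ _
    (x*y≡0 _ (x₂ - x₁) (x₂-x₁≢0 ne) (begin
      (2ℚ * y₁ * s + s * s * (x₂ - x₁)
        - (x₁ * x₁ + x₁ * x₂ + x₂ * x₂ + a)) * (x₂ - x₁)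
        ≡⟨ solve 7 (λ s x₁ y₁ x₂ y₂ a b →
             let D = x₂ :- x₁ in
             (con 2ℚ :* y₁ :* s :+ s :* s :* D
               :- (x₁ :* x₁ :+ x₁ :* x₂ :+ x₂ :* x₂ :+ a)) :* D
             := ((s :* D :- (y₂ :- y₁)) :* (s :* D :+ (y₂ :+ y₁))
                 :+ (y₂ :* y₂ :- (x₂ :* x₂ :* x₂ :+ a :* x₂ :+ b)))
                :- (y₁ :* y₁ :- (x₁ :* x₁ :* x₁ :+ a :* x₁ :+ b)))
             refl s x₁ y₁ x₂ y₂ a b ⟩
      ((s * (x₂ - x₁) - (y₂ - y₁)) * (s * (x₂ - x₁) + (y₂ + y₁))
        + (y₂ * y₂ - cubic x₂)) - (y₁ * y₁ - cubic x₁)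
        ≡⟨ cong₂ _-_ (cong₂ _+_ (zero* _ (x≡y⇒x-y≡0 eq)) (x≡y⇒x-y≡0 e₂))
                     (x≡y⇒x-y≡0 e₁) ⟩
      0ℚ ∎))
    where open ≡-Reasoning

  tangentSlope : ∀ s {x₁ y₁ x₂} → x₁ ≡ x₂ →
                 s * (2ℚ * y₁) ≡ 3ℚ * (x₁ * x₁) + a → Slope s x₁ y₁ x₂
  tangentSlope s {x₁} {y₁} refl eq = x-y≡0⇒x≡y _ _
    (trans (solve 4 (λ s x y a →
              con 2ℚ :* y :* s :+ s :* s :* (x :- x)
                :- (x :* x :+ x :* x :+ x :* x :+ a)
              := s :* (con 2ℚ :* y) :- (con 3ℚ :* (x :* x) :+ a))
              refl s x₁ y₁ a)
           (x≡y⇒x-y≡0 eq))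

  -- The reflection in the x-axis of the third intersection point.
  thirdPoint : ∀ s x₁ y₁ x₂ → .(y₁ * y₁ ≡ cubic x₁) → .(Slope s x₁ y₁ x₂) → Point
  thirdPoint s x₁ y₁ x₂ e sl =
    affine (thirdX s x₁ x₂) (thirdY s x₁ y₁ x₂) (onCurve s x₁ y₁ x₂ e sl)

  chord : ∀ x₁ y₁ x₂ y₂ → .(y₁ * y₁ ≡ cubic x₁) → .(y₂ * y₂ ≡ cubic x₂) →
          .(x₁ ≢ x₂) → .{{_ : NonZero (x₂ - x₁)}} → Point
  chord x₁ y₁ x₂ y₂ e₁ e₂ x₁≢x₂ =
    thirdPoint s x₁ y₁ x₂ e₁
      (chordSlope s {x₁} {y₁} {x₂} {y₂} e₁ e₂ x₁≢x₂ (÷-* (y₂ - y₁) (x₂ - x₁)))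
    where s = (y₂ - y₁) ÷ (x₂ - x₁)

  tangent : ∀ x₁ y₁ → .(y₁ * y₁ ≡ cubic x₁) → .{{_ : NonZero (2ℚ * y₁)}} → Point
  tangent x₁ y₁ e₁ =
    thirdPoint s x₁ y₁ x₁ e₁
      (tangentSlope s {x₁} {y₁} refl (÷-* (3ℚ * (x₁ * x₁) + a) (2ℚ * y₁)))
    where s = (3ℚ * (x₁ * x₁) + a) ÷ (2ℚ * y₁)

  infixl 6 _⊕_
  _⊕_ : Point → Point → Point
  ∞                ⊕ Q          = Q
  P@(affine _ _ _) ⊕ ∞          = P
  affine x₁ y₁ e₁ ⊕ affine x₂ y₂ e₂ with x₁ ≟ x₂
  ... | no  x₁≢x₂ = chord x₁ y₁ x₂ y₂ e₁ e₂ x₁≢x₂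
                        {{≢-nonZero (x₂-x₁≢0 x₁≢x₂)}}
  ... | yes x₁≡x₂ with y₁ ≟ - y₂
  ...   | yes _     = ∞
  ...   | no  y₁≢-y₂ = tangent x₁ y₁ e₁
                        {{≢-nonZero (2y≢0 {x₁} {y₁} {x₂} {y₂} e₁ e₂ x₁≡x₂ y₁≢-y₂)}}

  rawGroup : RawGroup 0ℓ 0ℓ
  rawGroup = record
    { Carrier = Point
    ; _≈_     = _≡_
    ; _∙_     = _⊕_
    ; ε       = ∞
    ; _⁻¹     = ⊖_
    }

record Finite (G : AbelianGroup 0ℓ 0ℓ) : Set where
  field
    size        : ℕ
    enumeration : Inverse (AbelianGroup.setoid G) (setoid (Fin size))

ℤ^_ : ℕ → AbelianGroup 0ℓ 0ℓ
ℤ^ r = record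
  { isAbelianGroup = Pointwise.isAbelianGroup (Fin r) ℤₚ.+-0-isAbelianGroup }

-- E(ℚ) ≅ ℤʳ ⊕ T with T a finite abelian group.  E(ℚ) is only packaged as
-- a raw group: the isomorphism transports the group laws to it.  That some
-- r satisfies this is the Mordell-Weil theorem, which is not proved here.
record HasRank (E : EllipticCurve) (r : ℕ) : Set₁ where
  field
    T        : AbelianGroup 0ℓ 0ℓ
    T-finite : Finite T

  ℤʳ⊕T : AbelianGroup 0ℓ 0ℓ
  ℤʳ⊕T = DirectProduct.abelianGroup (ℤ^ r) T

  field
    iso           : EllipticCurve.Point E → AbelianGroup.Carrier ℤʳ⊕T
    isIsomorphism : GroupMorphisms.IsGroupIsomorphism
                      (GroupLaw.rawGroup E) (AbelianGroup.rawGroup ℤʳ⊕T) iso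

0≤x*x : ∀ x → 0ℚ ≤ x * x
0≤x*x x with ≤-total 0ℚ x
... | inj₁ 0≤x = nonNegative⁻¹ (x * x) {{nonNeg*nonNeg⇒nonNeg x x}}
  where instance _ = nonNegative 0≤x
... | inj₂ x≤0 = nonNegative⁻¹ (x * x) {{nonPos*nonPos⇒nonPos x x}}
  where instance _ = nonPositive x≤0

4+27bb≢0 : ∀ b → 4ℚ * (1ℚ * 1ℚ * 1ℚ) + 27ℚ * (b * b) ≢ 0ℚ
4+27bb≢0 b eq = <-irrefl (sym eq)
  (+-mono-<-≤ (positive⁻¹ 4ℚ) (*-monoˡ-≤-nonNeg 27ℚ (0≤x*x b)))

-- y² = x³ + x - m⁶
E′ : ℤ → EllipticCurve
E′ m = record
  { a           = 1ℚ
  ; b           = - ((m ℤ.^ 6) / 1)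
  ; nonsingular = 4+27bb≢0 (- ((m ℤ.^ 6) / 1))
  }

{-# OPTIONS --safe #-}
-- Besides P = (m², m) the curve contains Q = (m⁶, m⁹), and P + Q has abscissa
-- (m⁴ + 1) / m².  If (p/q , y) doubles to a point of abscissa X and 4 X = c/d,
-- then d N = c C with N, C the quartic forms in p, q of the duplication formula.
-- For X the abscissa of P, Q or P + Q one can take c ≡ d ≡ 1 modulo n, where
-- n = 3 for P and Q, and n = 4 for P + Q (by m = 2m′ with m′ odd and
-- 4 X = (m⁴ + 1) / m′²), and N ≡ C modulo n forces p and q to have a common
-- factor.  So none of P, Q, P + Q is in 2 E(ℚ).
-- There is no rational 2-torsion: a root of x³ + x = m⁶ would be an integer,
-- but n³ + n is not a sixth power.  Hence doubling is injective on the finite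
-- group T, so T = 2T, and a point is in 2 E(ℚ) as soon as its coordinates in
-- ℤʳ are even.  For r ≤ 1 one of P, Q, P + Q has even coordinates.

module Submission where

open import Defs using (E′; HasRank)
open import Data.Nat.Base using (ℕ; _≤_)
open import Data.Integer.Base using (ℤ; +_; _<_)
open import Data.Integer.Divisibility using (_∣_)
open import Relation.Nullary using (¬_)

open import Defs
  using (EllipticCurve; module GroupLaw; Finite; 2ℚ; 3ℚ; 4ℚ;
         *-cancelʳ-NZ; ÷-*; x-y≡0⇒x≡y; x≡y⇒x-y≡0; zero*; x*y≡0)
open import Algebra.Bundles using (AbelianGroup)
open import Algebra.Morphism.Structures using (module GroupMorphisms)
import Algebra.Properties.AbelianGroup as AbelianGroupProperties
import Algebra.Properties.CommutativeSemigroup as CommutativeSemigroupProperties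
open import Data.Empty using (⊥; ⊥-elim)
open import Data.Fin.Base using (Fin; zero; suc; toℕ; fromℕ<; punchOut)
import Data.Fin.Properties as Fin
import Data.Integer.Base as ℤ
import Data.Integer.DivMod as ℤ
import Data.Integer.Divisibility.Signed as Signed
import Data.Integer.Properties as ℤ
open import Data.Integer.Solver using () renaming (module +-*-Solver to ℤ-Solver)
import Data.Nat.Base as ℕ
import Data.Nat.Coprimality as Coprimality
import Data.Nat.Divisibility as ℕ
import Data.Nat.Properties as ℕ
import Data.Nat.Solver as ℕ
open import Data.Product.Base using (∃; _×_; _,_; proj₁; proj₂)
open import Data.Rational.Base as ℚ using (ℚ; mkℚ; 0ℚ; 1ℚ; ↥_; ↧_)
import Data.Rational.Properties as ℚ
open import Data.Rational.Solver using () renaming (module +-*-Solver to ℚ-Solver)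
import Data.Rational.Unnormalised.Base as ℚᵘ
import Data.Rational.Unnormalised.Properties as ℚᵘ
open import Data.Sum.Base using (_⊎_; inj₁; inj₂)
open import Function.Bundles using (Inverse)
open import Function.Definitions using (Injective)
open import Level using (0ℓ)
open import Relation.Binary.PropositionalEquality hiding (setoid)
open import Relation.Nullary using (Dec; yes; no; contradiction)
open import Relation.Nullary.Decidable using (from-yes; _→-dec_; _×-dec_; recompute)

-- Doubling in a finite abelian group.

-- Pigeonhole: if `j` were missed, punching it out of the codomain would inject `Fin (suc n)` into
-- `Fin n`.
injective⇒surjective : ∀ {n} {f : Fin n → Fin n} → Injective _≡_ _≡_ f →
                       ∀ j → ∃ λ i → f i ≡ j
injective⇒surjective {ℕ.suc n} {f} inj j with Fin.any? (λ i → f i Fin.≟ j)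
... | yes hit = hit
... | no miss = contradiction (Fin.injective⇒≤ punched-injective) ℕ.1+n≰n
  where
  j≢f : ∀ i → j ≢ f i
  j≢f i eq = miss (i , sym eq)

  punched-injective : Injective _≡_ _≡_ (λ i → punchOut (j≢f i))
  punched-injective {i} {k} eq = inj (Fin.punchOut-injective (j≢f i) (j≢f k) eq)

module _ (G : AbelianGroup 0ℓ 0ℓ) where
  open AbelianGroup G hiding (refl; sym; trans)
  open AbelianGroupProperties G using (⁻¹-∙-comm; x∙y⁻¹≈ε⇒x≈y)
  open CommutativeSemigroupProperties commutativeSemigroup using (interchange)
  open import Relation.Binary.Reasoning.Setoid setoid

  doubling-injective : (∀ t → t ∙ t ≈ ε → t ≈ ε) → ∀ a b → a ∙ a ≈ b ∙ b → a ≈ b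
  doubling-injective no-2-torsion a b eq =
    x∙y⁻¹≈ε⇒x≈y a b (no-2-torsion (a ∙ b ⁻¹) (begin
      (a ∙ b ⁻¹) ∙ (a ∙ b ⁻¹)  ≈⟨ interchange a (b ⁻¹) a (b ⁻¹) ⟩
      (a ∙ a) ∙ (b ⁻¹ ∙ b ⁻¹)  ≈⟨ ∙-cong eq (⁻¹-∙-comm b b) ⟩
      (b ∙ b) ∙ (b ∙ b) ⁻¹     ≈⟨ inverseʳ (b ∙ b) ⟩
      ε                        ∎))

  -- The enumeration turns doubling into an injective self-map of `Fin size`, which is then
  -- surjective.
  doubling-surjective : Finite G → (∀ t → t ∙ t ≈ ε → t ≈ ε) →
                        ∀ t → ∃ λ u → u ∙ u ≈ t
  doubling-surjective finite no-2-torsion t =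
    let i , eq = injective⇒surjective double-injective (to t)
    in from i , from-double eq
    where
    open Finite finite
    open Inverse enumeration

    double : Fin size → Fin size
    double i = to (from i ∙ from i)

    from-double : ∀ {i u} → double i ≡ to u → from i ∙ from i ≈ u
    from-double {i} {u} eq = begin
      from i ∙ from i  ≈⟨ strictlyInverseʳ (from i ∙ from i) ⟨
      from (double i)  ≡⟨ cong from eq ⟩
      from (to u)      ≈⟨ strictlyInverseʳ u ⟩
      u                ∎

    double-injective : Injective _≡_ _≡_ double
    double-injective {i} {j} eq =
      trans (sym (strictlyInverseˡ i))
        (trans (to-cong (doubling-injective no-2-torsion (from i) (from j) (from-double eq)))
               (strictlyInverseˡ j))

-- Parity of integers.

-- Oddness of `i` is encoded as divisibility of `i + 1` by 2, so that both cases supply a quotient.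
even-or-odd : ∀ i → (+ 2 Signed.∣ i) ⊎ (+ 2 Signed.∣ ℤ.suc i)
even-or-odd i with i ℤ.%ℕ 2 | ℤ.n%ℕd<d i 2 | ℤ.a≡a%ℕn+[a/ℕn]*n i 2
... | 0 | _ | eq = inj₁ (Signed.divides (i ℤ./ℕ 2) (trans eq (ℤ.+-identityˡ _)))
... | 1 | _ | eq = inj₂ (Signed.divides (ℤ.suc (i ℤ./ℕ 2)) (trans (cong ℤ.suc eq)
  (solve 1 (λ q → con (+ 1) :+ (con (+ 1) :+ q :* con (+ 2))
                  := (con (+ 1) :+ q) :* con (+ 2)) refl (i ℤ./ℕ 2))))
  where open ℤ-Solver
... | ℕ.suc (ℕ.suc _) | ℕ.s≤s (ℕ.s≤s ()) | _

odd+odd : ∀ i j → + 2 Signed.∣ ℤ.suc i → + 2 Signed.∣ ℤ.suc j → + 2 Signed.∣ i ℤ.+ j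
odd+odd i j (Signed.divides p eqᵢ) (Signed.divides q eqⱼ) =
  Signed.divides (p ℤ.+ q ℤ.- + 1) (begin
    i ℤ.+ j
      ≡⟨ solve 2 (λ i j → i :+ j
                    := (con (+ 1) :+ i) :+ (con (+ 1) :+ j) :- con (+ 2)) refl i j ⟩
    ℤ.suc i ℤ.+ ℤ.suc j ℤ.- + 2
      ≡⟨ cong₂ (λ u v → u ℤ.+ v ℤ.- + 2) eqᵢ eqⱼ ⟩
    p ℤ.* + 2 ℤ.+ q ℤ.* + 2 ℤ.- + 2
      ≡⟨ solve 2 (λ p q → p :* con (+ 2) :+ q :* con (+ 2) :- con (+ 2)
                    := (p :+ q :- con (+ 1)) :* con (+ 2)) refl p q ⟩
    (p ℤ.+ q ℤ.- + 1) ℤ.* + 2 ∎)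
  where
  open ≡-Reasoning
  open ℤ-Solver

-- Halving points through the isomorphism with ℤʳ ⊕ T.

module Rank {E : EllipticCurve} where
  open EllipticCurve E using (Point; ∞)
  open GroupLaw E using (_⊕_; rawGroup)

  Halvable : Point → Set
  Halvable P = ∃ λ S → S ⊕ S ≡ P

  module _ {r : ℕ} (rank : HasRank E r) (no-2-torsion : ∀ S → S ⊕ S ≡ ∞ → S ≡ ∞) where
    open HasRank rank
    open AbelianGroup T using (_≈_; _∙_; ε; identityˡ)
    private module T = AbelianGroup T
    private module Z = AbelianGroup ℤʳ⊕T
    open GroupMorphisms.IsGroupIsomorphism isIsomorphism
      using (∙-homo; ε-homo; injective; surjective)

    preimage : ∀ z → ∃ λ S → iso S Z.≈ z
    preimage z = let S , image = surjective z in S , image refl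

    -- The point corresponding to `(0 , t)` doubles to `∞`, hence is `∞`, and so `t` is trivial.
    T-no-2-torsion : ∀ t → t ∙ t ≈ ε → t ≈ ε
    T-no-2-torsion t tt≈ε =
      let S , S↦t = preimage ((λ _ → + 0) , t)
          SS≡∞ = injective (Z.trans (∙-homo S S)
                   (Z.trans (Z.∙-cong S↦t S↦t)
                     (Z.trans ((λ _ → refl) , tt≈ε) (Z.sym ε-homo))))
      in T.trans (T.sym (proj₂ S↦t))
           (T.trans (T.reflexive (cong (λ P → proj₂ (iso P)) (no-2-torsion S SS≡∞)))
                    (proj₂ ε-homo))

    -- Both components can be halved: the one in ℤʳ by the given quotients, the one in `T` because
    -- doubling is surjective there. The isomorphism pulls the half back to the curve.
    even⇒halvable : ∀ P → (∀ i → + 2 Signed.∣ proj₁ (iso P) i) → Halvable P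
    even⇒halvable P even =
      let u , uu≈t = doubling-surjective T T-finite T-no-2-torsion (proj₂ (iso P))
          S , S↦half = preimage ((λ i → Signed.quotient (even i)) , u)
      in S , injective (Z.trans (∙-homo S S) (Z.trans (Z.∙-cong S↦half S↦half)
               ((λ i → trans (q+q≡q*2 (Signed.quotient (even i)))
                             (sym (Signed._∣_.equality (even i)))) , uu≈t)))
      where
      q+q≡q*2 : ∀ q → q ℤ.+ q ≡ q ℤ.* + 2
      q+q≡q*2 = solve 1 (λ q → q :+ q := q :* con (+ 2)) refl
        where open ℤ-Solver

  2≤rank : ∀ {r} → HasRank E r → (∀ S → S ⊕ S ≡ ∞ → S ≡ ∞) → ∀ P Q →
           ¬ Halvable P → ¬ Halvable Q → ¬ Halvable (P ⊕ Q) → 2 ≤ r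
  2≤rank {0} rank no-2-torsion P Q ¬½P _ _ =
    -- With no free coordinates the evenness condition is vacuous, so every point is halvable.
    contradiction (even⇒halvable rank no-2-torsion P (λ ())) ¬½P
  2≤rank {1} rank no-2-torsion P Q ¬½P ¬½Q ¬½P+Q =
    ⊥-elim (case-parity (even-or-odd (coordinate P)) (even-or-odd (coordinate Q)))
    where
    coordinate : Point → ℤ
    coordinate R = proj₁ (HasRank.iso rank R) zero

    halvable : ∀ R → + 2 Signed.∣ coordinate R → Halvable R
    halvable R even = even⇒halvable rank no-2-torsion R (λ { zero → even })

    open GroupMorphisms.IsGroupIsomorphism (HasRank.isIsomorphism rank) using (∙-homo)

    case-parity : (+ 2 Signed.∣ coordinate P) ⊎ (+ 2 Signed.∣ ℤ.suc (coordinate P)) →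
                  (+ 2 Signed.∣ coordinate Q) ⊎ (+ 2 Signed.∣ ℤ.suc (coordinate Q)) → ⊥
    case-parity (inj₁ evenP) _            = ¬½P (halvable P evenP)
    case-parity (inj₂ _)     (inj₁ evenQ) = ¬½Q (halvable Q evenQ)
    case-parity (inj₂ oddP)  (inj₂ oddQ)  = ¬½P+Q (halvable (P ⊕ Q)
      (subst (+ 2 Signed.∣_) (sym (proj₁ (∙-homo P Q) zero))
        (odd+odd (coordinate P) (coordinate Q) oddP oddQ)))
  2≤rank {ℕ.suc (ℕ.suc _)} _ _ _ _ _ _ _ = ℕ.s≤s (ℕ.s≤s ℕ.z≤n)

-- The embedding of ℤ in ℚ.

-- Built with `mkℚ` rather than `_/ 1`, so that the numerator is definitionally `i` and no gcd has
-- to be normalised.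
ι : ℤ → ℚ
ι i = mkℚ i 0 (Coprimality.sym (Coprimality.1-coprimeTo ℤ.∣ i ∣))

/1≡ι : ∀ i → i ℚ./ 1 ≡ ι i
/1≡ι i = ℚ.fromℚᵘ-toℚᵘ (ι i)

ι-injective : ∀ {i j} → ι i ≡ ι j → i ≡ j
ι-injective = cong ↥_

infixl 6 _⟨+⟩_ _⟨-⟩_
infixl 7 _⟨*⟩_

-- This and the next operators mirror integer arithmetic: a proof term shaped like an integer
-- expression carries it to the corresponding rational expression, replacing the leaves along given
-- equations.
_⟨+⟩_ : ∀ {i j x y} → ι i ≡ x → ι j ≡ y → ι (i ℤ.+ j) ≡ x ℚ.+ y
_⟨+⟩_ {i} {j} refl refl = sym (trans
  (cong₂ (λ u v → (u ℤ.+ v) ℚ./ 1) (ℤ.*-identityʳ i) (ℤ.*-identityʳ j))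
  (/1≡ι (i ℤ.+ j)))

_⟨*⟩_ : ∀ {i j x y} → ι i ≡ x → ι j ≡ y → ι (i ℤ.* j) ≡ x ℚ.* y
_⟨*⟩_ {i} {j} refl refl = sym (/1≡ι (i ℤ.* j))

⟨-⟩_ : ∀ {i x} → ι i ≡ x → ι (ℤ.- i) ≡ ℚ.- x
⟨-⟩_ {+ 0}        refl = refl
⟨-⟩_ {+ ℕ.suc _}  refl = refl
⟨-⟩_ {ℤ.-[1+ _ ]} refl = refl

_⟨-⟩_ : ∀ {i j x y} → ι i ≡ x → ι j ≡ y → ι (i ℤ.- j) ≡ x ℚ.- y
r ⟨-⟩ s = r ⟨+⟩ (⟨-⟩ s)

ι-↥ : ∀ x → ι (↥ x) ≡ x ℚ.* ι (↧ x)
ι-↥ x@(mkℚ p d _) = ℚ.toℚᵘ-injective (ℚᵘ.≃-sym (ℚᵘ.≃-trans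
  (ℚ.toℚᵘ-homo-* x (ι (↧ x)))
  (ℚᵘ.*≡* (solve 2 (λ p q → p :* q :* con (+ 1) := p :* (q :* con (+ 1)))
             refl p (+ ℕ.suc d)))))
  where open ℤ-Solver

-- The duplication forms and their reductions modulo n.

-- For S = (p/q , y) on y² = x³ + x − M, the abscissa of 2S is N / 4C.
N C : ℤ → ℤ → ℤ → ℤ
N p q M = (p ℤ.* p ℤ.- q ℤ.* q) ℤ.* (p ℤ.* p ℤ.- q ℤ.* q)
          ℤ.+ + 8 ℤ.* (M ℤ.* (p ℤ.* (q ℤ.* (q ℤ.* q))))
C p q M = q ℤ.* (p ℤ.* (p ℤ.* p ℤ.+ q ℤ.* q) ℤ.- M ℤ.* (q ℤ.* (q ℤ.* q)))

infix 4 _≈_mod_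
-- A record rather than a synonym for divisibility of `a - b`, so that unification can recover `a`,
-- `b` and `n`.
record _≈_mod_ (a b n : ℤ) : Set where
  constructor congruent
  field n∣a-b : n Signed.∣ a ℤ.- b

open _≈_mod_

module Congruence {n : ℤ} where

  private
    infix 4 _≈_
    _≈_ : ℤ → ℤ → Set
    a ≈ b = a ≈ b mod n

  ≈-refl : ∀ {a} → a ≈ a
  ≈-refl {a} = congruent (Signed.divides (+ 0) (ℤ.+-inverseʳ a))

  ≈-sym : ∀ {a b} → a ≈ b → b ≈ a
  ≈-sym {a} {b} (congruent n∣) = congruent (subst (n Signed.∣_)
    (solve 2 (λ a b → :- (a :- b) := b :- a) refl a b) (Signed.∣m⇒∣-m n∣))
    where open ℤ-Solver

  ≈-trans : ∀ {a b c} → a ≈ b → b ≈ c → a ≈ c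
  ≈-trans {a} {b} {c} (congruent n∣) (congruent n∣′) = congruent (subst (n Signed.∣_)
    (solve 3 (λ a b c → (a :- b) :+ (b :- c) := a :- c) refl a b c)
    (Signed.∣m∣n⇒∣m+n n∣ n∣′))
    where open ℤ-Solver

  infixl 6 _[+]_ _[-]_
  infixl 7 _[*]_

  _[+]_ : ∀ {a b c d} → a ≈ b → c ≈ d → a ℤ.+ c ≈ b ℤ.+ d
  _[+]_ {a} {b} {c} {d} (congruent n∣) (congruent n∣′) = congruent (subst (n Signed.∣_)
    (solve 4 (λ a b c d → (a :- b) :+ (c :- d) := (a :+ c) :- (b :+ d)) refl a b c d)
    (Signed.∣m∣n⇒∣m+n n∣ n∣′))
    where open ℤ-Solver

  _[-]_ : ∀ {a b c d} → a ≈ b → c ≈ d → a ℤ.- c ≈ b ℤ.- d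
  _[-]_ {a} {b} {c} {d} (congruent n∣) (congruent n∣′) = congruent (subst (n Signed.∣_)
    (solve 4 (λ a b c d → (a :- b) :- (c :- d) := (a :- c) :- (b :- d)) refl a b c d)
    (Signed.∣m∣n⇒∣m-n n∣ n∣′))
    where open ℤ-Solver

  _[*]_ : ∀ {a b c d} → a ≈ b → c ≈ d → a ℤ.* c ≈ b ℤ.* d
  _[*]_ {a} {b} {c} {d} (congruent n∣) (congruent n∣′) = congruent (subst (n Signed.∣_)
    (solve 4 (λ a b c d → (a :- b) :* c :+ b :* (c :- d) := a :* c :- b :* d) refl a b c d)
    (Signed.∣m∣n⇒∣m+n (Signed.∣m⇒∣m*n c n∣) (Signed.∣n⇒∣m*n b n∣′)))
    where open ℤ-Solver

  N-cong : ∀ {p p′ q q′ M M′} → p ≈ p′ → q ≈ q′ → M ≈ M′ → N p q M ≈ N p′ q′ M′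
  N-cong p q M = (p [*] p [-] q [*] q) [*] (p [*] p [-] q [*] q)
                 [+] ≈-refl {+ 8} [*] (M [*] (p [*] (q [*] (q [*] q))))

  C-cong : ∀ {p p′ q q′ M M′} → p ≈ p′ → q ≈ q′ → M ≈ M′ → C p q M ≈ C p′ q′ M′
  C-cong p q M = q [*] (p [*] (p [*] p [+] q [*] q) [-] M [*] (q [*] (q [*] q)))

open Congruence

residue : ∀ n .{{_ : ℕ.NonZero n}} i → ∃ λ (r : Fin n) → i ≈ + toℕ r mod (+ n)
residue n i = fromℕ< i%n<n , congruent (Signed.divides (i ℤ./ℕ n) (begin
  i ℤ.- + toℕ (fromℕ< i%n<n)
    ≡⟨ cong₂ (λ u v → u ℤ.- + v) (ℤ.a≡a%ℕn+[a/ℕn]*n i n) (Fin.toℕ-fromℕ< i%n<n) ⟩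
  + (i ℤ.%ℕ n) ℤ.+ (i ℤ./ℕ n) ℤ.* + n ℤ.- + (i ℤ.%ℕ n)
    ≡⟨ solve 2 (λ r s → r :+ s :- r := s) refl (+ (i ℤ.%ℕ n)) ((i ℤ./ℕ n) ℤ.* + n) ⟩
  (i ℤ./ℕ n) ℤ.* + n ∎))
  where
  open ≡-Reasoning
  open ℤ-Solver
  i%n<n = ℤ.n%ℕd<d i n

∣-resp-≈ : ∀ {a b n l} → l Signed.∣ n → a ≈ b mod n → l Signed.∣ b → l Signed.∣ a
∣-resp-≈ {a} {b} {n} {l} l∣n (congruent n∣) l∣b = subst (l Signed.∣_)
  (solve 2 (λ a b → (a :- b) :+ b := a) refl a b)
  (Signed.∣m∣n⇒∣m+n (Signed.∣-trans l∣n n∣) l∣b)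
  where open ℤ-Solver

-- The factors 1 are the residues of d and c in d N = c C.
Obstruction : (n l : ℕ) → ℤ → Set
Obstruction n l M = (i j : Fin n) →
  + n Signed.∣ + 1 ℤ.* N (+ toℕ i) (+ toℕ j) M ℤ.- + 1 ℤ.* C (+ toℕ i) (+ toℕ j) M →
  (+ l Signed.∣ + toℕ i) × (+ l Signed.∣ + toℕ j)

obstruction? : ∀ n l M → Dec (Obstruction n l M)
obstruction? n l M = Fin.all? λ i → Fin.all? λ j →
  (_ Signed.∣? _) →-dec ((_ Signed.∣? _) ×-dec (_ Signed.∣? _))

-- Decided by evaluating all nine pairs of residues; `M` is 1 modulo 3 when 3 does not divide `m`.
obstruction₃ : Obstruction 3 3 (+ 1)
obstruction₃ = from-yes (obstruction? 3 3 (+ 1))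

-- Here `M` is 0, as `m` is even. The pair (2 , 2) solves the congruence modulo 4, so the common
-- factor obtained is 2 and not 4.
obstruction₄ : Obstruction 4 2 (+ 0)
obstruction₄ = from-yes (obstruction? 4 2 (+ 0))

module _ {n l : ℕ} {M₀ : ℤ} .{{_ : ℕ.NonZero n}} (obstruction : Obstruction n l M₀)
         (l∣n : + l Signed.∣ + n) (l≢1 : l ≢ 1) where

  -- Reducing the equation modulo `n` makes `l` divide the residues of numerator and denominator. As
  -- `l` divides `n`, it divides both of them, against lowest terms.
  no-common-solution : ∀ {c d M} → c ≈ + 1 mod (+ n) → d ≈ + 1 mod (+ n) → M ≈ M₀ mod (+ n) →
                       ∀ x → d ℤ.* N (↥ x) (↧ x) M ≢ c ℤ.* C (↥ x) (↧ x) M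
  no-common-solution c≈1 d≈1 M≈M₀ x@(mkℚ p q-1 coprime) eq =
    let r , p≈r = residue n p
        s , q≈s = residue n (↧ x)
        l∣r , l∣s = obstruction r s (n∣a-b (≈-trans
          (≈-sym (d≈1 [*] N-cong p≈r q≈s M≈M₀))
          (subst (_≈ _ mod (+ n)) (sym eq) (c≈1 [*] C-cong p≈r q≈s M≈M₀))))
    in l≢1 (Coprimality.recompute coprime
         (Signed.∣⇒∣ᵤ (∣-resp-≈ l∣n p≈r l∣r) , Signed.∣⇒∣ᵤ (∣-resp-≈ l∣n q≈s l∣s)))

-- Abscissae of sums and doubles, and 2-torsion.

module Abscissae (E : EllipticCurve) where
  open EllipticCurve E
  open GroupLaw E

  -- A relation and not a function, since `∞` has no abscissa.
  data HasAbscissa : Point → ℚ → Set where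
    hasAbscissa : ∀ {x y} .{eq : y ℚ.* y ≡ cubic x} → HasAbscissa (affine x y eq) x

  -- The slope is exposed only through its defining equation, which spares later computations the
  -- division.
  chord-abscissa : ∀ {x₁ y₁ x₂ y₂} .{e₁ : y₁ ℚ.* y₁ ≡ cubic x₁} .{e₂ : y₂ ℚ.* y₂ ≡ cubic x₂} →
                   x₁ ≢ x₂ → ∃ λ s → s ℚ.* (x₂ ℚ.- x₁) ≡ y₂ ℚ.- y₁ ×
                   HasAbscissa (affine x₁ y₁ e₁ ⊕ affine x₂ y₂ e₂) (s ℚ.* s ℚ.- x₁ ℚ.- x₂)
  chord-abscissa {x₁} {y₁} {x₂} {y₂} x₁≢x₂ with x₁ ℚ.≟ x₂
  ... | yes x₁≡x₂ = contradiction x₁≡x₂ x₁≢x₂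
  ... | no  x₁≢x₂ = (y₂ ℚ.- y₁) ℚ.÷ (x₂ ℚ.- x₁) , ÷-* (y₂ ℚ.- y₁) (x₂ ℚ.- x₁) , hasAbscissa
    where instance _ = ℚ.≢-nonZero (x₂-x₁≢0 x₁≢x₂)

  -- The tangent has slope s = (3x² + a) / 2y and X = s² - 2x. Multiplying by 4y² and replacing y²
  -- by the cubic eliminates y.
  double-abscissa : ∀ S {X} → HasAbscissa (S ⊕ S) X → ∃ λ x →
    4ℚ ℚ.* X ℚ.* cubic x ≡ (3ℚ ℚ.* (x ℚ.* x) ℚ.+ a) ℚ.* (3ℚ ℚ.* (x ℚ.* x) ℚ.+ a)
                           ℚ.- ι (+ 8) ℚ.* x ℚ.* cubic x
  double-abscissa (affine x y eq) h with x ℚ.≟ x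
  ... | no x≢x = contradiction refl x≢x
  ... | yes x≡x with y ℚ.≟ ℚ.- y
  -- In the omitted cases, S = `∞` and y = -y, the double is `∞` and has no abscissa.
  double-abscissa (affine x y eq) hasAbscissa | yes x≡x | no y≢-y = x , (begin
    4ℚ ℚ.* (s ℚ.* s ℚ.- x ℚ.- x) ℚ.* cubic x
      ≡⟨ cong (4ℚ ℚ.* (s ℚ.* s ℚ.- x ℚ.- x) ℚ.*_) y²≡cubic ⟨
    4ℚ ℚ.* (s ℚ.* s ℚ.- x ℚ.- x) ℚ.* (y ℚ.* y)
      ≡⟨ solve 3 (λ s x y → con 4ℚ :* (s :* s :- x :- x) :* (y :* y)
                   := (s :* (con 2ℚ :* y)) :* (s :* (con 2ℚ :* y))
                      :- con (ι (+ 8)) :* x :* (y :* y)) refl s x y ⟩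
    (s ℚ.* (2ℚ ℚ.* y)) ℚ.* (s ℚ.* (2ℚ ℚ.* y)) ℚ.- ι (+ 8) ℚ.* x ℚ.* (y ℚ.* y)
      ≡⟨ cong₂ (λ u v → u ℚ.* u ℚ.- ι (+ 8) ℚ.* x ℚ.* v)
           (÷-* (3ℚ ℚ.* (x ℚ.* x) ℚ.+ a) (2ℚ ℚ.* y)) y²≡cubic ⟩
    (3ℚ ℚ.* (x ℚ.* x) ℚ.+ a) ℚ.* (3ℚ ℚ.* (x ℚ.* x) ℚ.+ a) ℚ.- ι (+ 8) ℚ.* x ℚ.* cubic x ∎)
    where
    open ≡-Reasoning
    open ℚ-Solver
    y²≡cubic : y ℚ.* y ≡ cubic x
    y²≡cubic = recompute (y ℚ.* y ℚ.≟ cubic x) eq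
    instance _ = ℚ.≢-nonZero (2y≢0 {x} {y} {x} {y} y²≡cubic y²≡cubic x≡x y≢-y)
    s = (3ℚ ℚ.* (x ℚ.* x) ℚ.+ a) ℚ.÷ (2ℚ ℚ.* y)

  -- An affine point doubles to `∞` only if y = -y, that is y = 0, and then x is a root of the
  -- cubic.
  no-root⇒no-2-torsion : (∀ x → cubic x ≢ 0ℚ) → ∀ S → S ⊕ S ≡ ∞ → S ≡ ∞
  no-root⇒no-2-torsion no-root ∞ _ = refl
  no-root⇒no-2-torsion no-root (affine x y eq) SS≡∞ with x ℚ.≟ x
  ... | no x≢x = contradiction refl x≢x
  ... | yes _ with y ℚ.≟ ℚ.- y
  ... | yes y≡-y = ⊥-elim (no-root x (trans (sym (recompute (y ℚ.* y ℚ.≟ cubic x) eq))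
                                            (zero* y y≡0)))
    where
    open ℚ-Solver
    y≡0 : y ≡ 0ℚ
    y≡0 = x*y≡0 y 2ℚ (λ ()) (trans
      (solve 1 (λ y → y :* con 2ℚ := y :- (:- y)) refl y) (x≡y⇒x-y≡0 y≡-y))
  no-root⇒no-2-torsion no-root (affine x y eq) () | yes _ | no _

-- The cubic x³ + x - k⁶ has no rational root.

infixr 8 _^6
_^6 : ℕ → ℕ
k ^6 = (k ℕ.* k) ℕ.* (k ℕ.* k) ℕ.* (k ℕ.* k)

∣p*p+q*q∣ : ∀ p q → ℤ.∣ p ℤ.* p ℤ.+ q ℤ.* q ∣ ≡ ℤ.∣ p ∣ ℕ.* ℤ.∣ p ∣ ℕ.+ ℤ.∣ q ∣ ℕ.* ℤ.∣ q ∣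
∣p*p+q*q∣ p q = cong₂ (λ u v → ℤ.∣ u ℤ.+ v ∣) (square p) (square q)
  where
  square : ∀ i → i ℤ.* i ≡ + (ℤ.∣ i ∣ ℕ.* ℤ.∣ i ∣)
  square (+ n)      = sym (ℤ.pos-* n n)
  square ℤ.-[1+ n ] = refl

-- k⁶ would lie strictly between n³ and (n + 1)³.
n³+n≢k⁶ : ∀ n k .{{_ : ℕ.NonZero k}} → n ℕ.* (n ℕ.* n ℕ.+ 1) ≢ k ^6
n³+n≢k⁶ n k eq with ℕ.<-≤-connex n (k ℕ.* k)
... | inj₁ n<k² = ℕ.<-irrefl eq (ℕ.<-≤-trans n³+n<[n+1]³
  (ℕ.*-mono-≤ (ℕ.*-mono-≤ n<k² n<k²) n<k²))
  where
  open ℕ.+-*-Solver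
  n³+n<[n+1]³ : n ℕ.* (n ℕ.* n ℕ.+ 1) ℕ.< ℕ.suc n ℕ.* ℕ.suc n ℕ.* ℕ.suc n
  n³+n<[n+1]³ = subst (n ℕ.* (n ℕ.* n ℕ.+ 1) ℕ.<_)
    (solve 1 (λ n → con 1 :+ (n :* (n :* n :+ con 1) :+ (con 3 :* (n :* n) :+ con 2 :* n))
                := (con 1 :+ n) :* (con 1 :+ n) :* (con 1 :+ n)) refl n)
    (ℕ.s≤s (ℕ.m≤m+n _ _))
... | inj₂ k²≤n = ℕ.<-irrefl (sym eq) (begin-strict
  k ^6                       ≤⟨ ℕ.*-mono-≤ (ℕ.*-mono-≤ k²≤n k²≤n) k²≤n ⟩
  n ℕ.* n ℕ.* n              <⟨ ℕ.m<m+n _ (ℕ.<-≤-trans (ℕ.>-nonZero⁻¹ (k ℕ.* k)) k²≤n) ⟩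
  n ℕ.* n ℕ.* n ℕ.+ n        ≡⟨ solve 1 (λ n → n :* n :* n :+ n := n :* (n :* n :+ con 1)) refl n ⟩
  n ℕ.* (n ℕ.* n ℕ.+ 1)      ∎)
  where
  open ℕ.≤-Reasoning
  open ℕ.+-*-Solver
  instance _ = ℕ.m*n≢0 k k

-- The rational root argument: for p/q in lowest terms, vanishing of `C` gives n³ + nq² = k⁶q³ with
-- n = ∣p∣. Then q divides n³ and is coprime to n, so q = 1 and n³ + n = k⁶.
C≢0 : ∀ k .{{_ : ℕ.NonZero k}} x → C (↥ x) (↧ x) (+ (k ^6)) ≢ + 0
C≢0 k x@(mkℚ p q-1 coprime) eq = contradiction
  (subst (λ q → n ℕ.* (n ℕ.* n ℕ.+ q ℕ.* q) ≡ k ^6 ℕ.* (q ℕ.* (q ℕ.* q))) q≡1 cleared)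
  (λ eq → n³+n≢k⁶ n k (trans eq (ℕ.*-identityʳ _)))
  where
  open ≡-Reasoning
  n = ℤ.∣ p ∣
  q = ℕ.suc q-1

  cleared : n ℕ.* (n ℕ.* n ℕ.+ q ℕ.* q) ≡ k ^6 ℕ.* (q ℕ.* (q ℕ.* q))
  cleared = begin
    n ℕ.* (n ℕ.* n ℕ.+ q ℕ.* q)             ≡⟨ cong (n ℕ.*_) (∣p*p+q*q∣ p (+ q)) ⟨
    n ℕ.* ℤ.∣ p ℤ.* p ℤ.+ + q ℤ.* + q ∣     ≡⟨ ℤ.abs-* p (p ℤ.* p ℤ.+ + q ℤ.* + q) ⟨
    ℤ.∣ p ℤ.* (p ℤ.* p ℤ.+ + q ℤ.* + q) ∣
      ≡⟨ cong ℤ.∣_∣ (ℤ.i-j≡0⇒i≡j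
           (p ℤ.* (p ℤ.* p ℤ.+ + q ℤ.* + q)) (+ (k ^6) ℤ.* (+ q ℤ.* (+ q ℤ.* + q)))
           (ℤ.*-cancelˡ-≡ (+ q) _ (+ 0)
           (trans eq (sym (ℤ.*-zeroʳ (+ q)))))) ⟩
    ℤ.∣ + (k ^6) ℤ.* (+ q ℤ.* (+ q ℤ.* + q)) ∣
      ≡⟨ trans (ℤ.abs-* (+ (k ^6)) (+ q ℤ.* (+ q ℤ.* + q))) (cong (k ^6 ℕ.*_)
           (trans (ℤ.abs-* (+ q) (+ q ℤ.* + q)) (cong (q ℕ.*_) (ℤ.abs-* (+ q) (+ q))))) ⟩
    k ^6 ℕ.* (q ℕ.* (q ℕ.* q))              ∎

  q-coprime-n : Coprimality.Coprime q n
  q-coprime-n = Coprimality.sym (Coprimality.recompute coprime)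

  q∣n³ : q ℕ.∣ n ℕ.* (n ℕ.* n)
  q∣n³ = ℕ.∣m+n∣m⇒∣n
    (subst (q ℕ.∣_) (trans (sym cleared) (trans (ℕ.*-distribˡ-+ n (n ℕ.* n) (q ℕ.* q))
                                                (ℕ.+-comm (n ℕ.* (n ℕ.* n)) _)))
      (ℕ.∣n⇒∣m*n (k ^6) (ℕ.m∣m*n (q ℕ.* q))))
    (ℕ.∣n⇒∣m*n n (ℕ.m∣m*n q))

  q∣n : q ℕ.∣ n
  q∣n = Coprimality.coprime-divisor q-coprime-n (Coprimality.coprime-divisor q-coprime-n q∣n³)

  q≡1 : q ≡ 1
  q≡1 = q-coprime-n (ℕ.∣-refl , q∣n)

m^6≡m²m²m² : ∀ m → m ℤ.^ 6 ≡ (m ℤ.* m) ℤ.* (m ℤ.* m) ℤ.* (m ℤ.* m)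
m^6≡m²m²m² = solve 1 (λ m → m :* (m :* (m :* (m :* (m :* (m :* con (+ 1))))))
                        := (m :* m) :* (m :* m) :* (m :* m)) refl
  where open ℤ-Solver

-- The duplication formula on `E′ m` in integers.

module E′-Properties (m : ℤ) where
  open EllipticCurve (E′ m)
  open GroupLaw (E′ m)
  open Abscissae (E′ m) public
  open ℚ-Solver

  private
    M : ℤ
    M = m ℤ.^ 6

    M/1 : ℚ
    M/1 = M ℚ./ 1

    ι-M : ι M ≡ M/1
    ι-M = sym (/1≡ι M)

  -- Put p = xq in the quartic form and use (x² - 1)² + 8Mx = (3x² + 1)² - 8x(x³ + x - M).
  ι-N : ∀ x → let Q = ι (↧ x) in
        ι (N (↥ x) (↧ x) M) ≡ Q ℚ.* Q ℚ.* Q ℚ.* Q ℚ.*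
          ((3ℚ ℚ.* (x ℚ.* x) ℚ.+ 1ℚ) ℚ.* (3ℚ ℚ.* (x ℚ.* x) ℚ.+ 1ℚ) ℚ.- ι (+ 8) ℚ.* x ℚ.* cubic x)
  ι-N x = trans
    ((p ⟨*⟩ p ⟨-⟩ q ⟨*⟩ q) ⟨*⟩ (p ⟨*⟩ p ⟨-⟩ q ⟨*⟩ q)
      ⟨+⟩ refl {x = ι (+ 8)} ⟨*⟩ (ι-M ⟨*⟩ (p ⟨*⟩ (q ⟨*⟩ (q ⟨*⟩ q)))))
    (solve 3 (λ x q M →
      let p = x :* q
          P = con 3ℚ :* (x :* x) :+ con 1ℚ
      in (p :* p :- q :* q) :* (p :* p :- q :* q) :+ con (ι (+ 8)) :* (M :* (p :* (q :* (q :* q))))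
         := q :* q :* q :* q :* (P :* P :- con (ι (+ 8)) :* x :* (x :* x :* x :+ con 1ℚ :* x :- M)))
      refl x (ι (↧ x)) M/1)
    where
    p : ι (↥ x) ≡ x ℚ.* ι (↧ x)
    p = ι-↥ x
    q : ι (↧ x) ≡ ι (↧ x)
    q = refl

  ι-C : ∀ x → let Q = ι (↧ x) in
        ι (C (↥ x) (↧ x) M) ≡ Q ℚ.* Q ℚ.* Q ℚ.* Q ℚ.* cubic x
  ι-C x = trans
    (q ⟨*⟩ (p ⟨*⟩ (p ⟨*⟩ p ⟨+⟩ q ⟨*⟩ q) ⟨-⟩ ι-M ⟨*⟩ (q ⟨*⟩ (q ⟨*⟩ q))))
    (solve 3 (λ x q M →
      let p = x :* q
      in q :* (p :* (p :* p :+ q :* q) :- M :* (q :* (q :* q)))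
         := q :* q :* q :* q :* (x :* x :* x :+ con 1ℚ :* x :- M))
      refl x (ι (↧ x)) M/1)
    where
    p : ι (↥ x) ≡ x ℚ.* ι (↧ x)
    p = ι-↥ x
    q : ι (↧ x) ≡ ι (↧ x)
    q = refl

  -- This is `double-abscissa` multiplied by d q⁴, where q is the denominator of x.
  double-abscissa-integral : ∀ {c d X} → ι d ℚ.* (4ℚ ℚ.* X) ≡ ι c →
    ∀ S → HasAbscissa (S ⊕ S) X → ∃ λ x → d ℤ.* N (↥ x) (↧ x) M ≡ c ℤ.* C (↥ x) (↧ x) M
  double-abscissa-integral {c} {d} {X} 4X≡c/d S 2S↦X =
    let x , eq = double-abscissa S 2S↦X
        Q = ι (↧ x)
        Q⁴ = Q ℚ.* Q ℚ.* Q ℚ.* Q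
    in x , ι-injective (begin
      ι (d ℤ.* N (↥ x) (↧ x) M)                     ≡⟨ refl {x = ι d} ⟨*⟩ ι-N x ⟩
      ι d ℚ.* (Q⁴ ℚ.* _)                            ≡⟨ cong (λ u → ι d ℚ.* (Q⁴ ℚ.* u)) eq ⟨
      ι d ℚ.* (Q⁴ ℚ.* (4ℚ ℚ.* X ℚ.* cubic x))       ≡⟨ solve 4 (λ d q X c →
                                                         d :* (q :* (con 4ℚ :* X :* c))
                                                         := (d :* (con 4ℚ :* X)) :* (q :* c))
                                                         refl (ι d) Q⁴ X (cubic x) ⟩
      ι d ℚ.* (4ℚ ℚ.* X) ℚ.* (Q⁴ ℚ.* cubic x)       ≡⟨ cong (ℚ._* (Q⁴ ℚ.* cubic x)) 4X≡c/d ⟩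
      ι c ℚ.* (Q⁴ ℚ.* cubic x)                      ≡⟨ refl {x = ι c} ⟨*⟩ ι-C x ⟨
      ι (c ℤ.* C (↥ x) (↧ x) M)                     ∎)
    where open ≡-Reasoning

-- The abscissa of P + Q.

module _ (μ : ℚ) where
  private
    μ² = μ ℚ.* μ
    μ⁶ = μ² ℚ.* μ² ℚ.* μ²
    μ⁹ = μ⁶ ℚ.* μ² ℚ.* μ

  -- The chord has slope (μ⁹ - μ) / (μ⁶ - μ²) = (μ⁴ + 1) / μ, and (μ⁴ + 1)² - μ⁴ - μ⁸ = μ⁴ + 1.
  third-abscissa : ∀ s → μ² ≢ μ⁶ → s ℚ.* (μ⁶ ℚ.- μ²) ≡ μ⁹ ℚ.- μ →
                   (s ℚ.* s ℚ.- μ² ℚ.- μ⁶) ℚ.* μ² ≡ μ² ℚ.* μ² ℚ.+ 1ℚ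
  third-abscissa s μ²≢μ⁶ slope = begin
    (s ℚ.* s ℚ.- μ² ℚ.- μ⁶) ℚ.* μ²
      ≡⟨ solve 2 (λ s μ → let μ² = μ :* μ; μ⁶ = μ² :* μ² :* μ² in
           (s :* s :- μ² :- μ⁶) :* μ² := (s :* μ) :* (s :* μ) :- μ² :* μ² :- μ⁶ :* μ²) refl s μ ⟩
    (s ℚ.* μ) ℚ.* (s ℚ.* μ) ℚ.- μ² ℚ.* μ² ℚ.- μ⁶ ℚ.* μ²
      ≡⟨ cong (λ u → u ℚ.* u ℚ.- μ² ℚ.* μ² ℚ.- μ⁶ ℚ.* μ²) sμ≡μ⁴+1 ⟩
    (μ² ℚ.* μ² ℚ.+ 1ℚ) ℚ.* (μ² ℚ.* μ² ℚ.+ 1ℚ) ℚ.- μ² ℚ.* μ² ℚ.- μ⁶ ℚ.* μ²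
      ≡⟨ solve 1 (λ μ → let μ² = μ :* μ; μ⁶ = μ² :* μ² :* μ² in
           (μ² :* μ² :+ con 1ℚ) :* (μ² :* μ² :+ con 1ℚ) :- μ² :* μ² :- μ⁶ :* μ²
           := μ² :* μ² :+ con 1ℚ) refl μ ⟩
    μ² ℚ.* μ² ℚ.+ 1ℚ ∎
    where
    open ≡-Reasoning
    open ℚ-Solver
    instance _ = ℚ.≢-nonZero (λ eq → μ²≢μ⁶ (sym (x-y≡0⇒x≡y μ⁶ μ² eq)))

    sμ≡μ⁴+1 : s ℚ.* μ ≡ μ² ℚ.* μ² ℚ.+ 1ℚ
    sμ≡μ⁴+1 = *-cancelʳ-NZ (μ⁶ ℚ.- μ²) (s ℚ.* μ) (μ² ℚ.* μ² ℚ.+ 1ℚ) (begin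
      s ℚ.* μ ℚ.* (μ⁶ ℚ.- μ²)
        ≡⟨ solve 3 (λ s μ d → s :* μ :* d := μ :* (s :* d)) refl s μ (μ⁶ ℚ.- μ²) ⟩
      μ ℚ.* (s ℚ.* (μ⁶ ℚ.- μ²))
        ≡⟨ cong (μ ℚ.*_) slope ⟩
      μ ℚ.* (μ⁹ ℚ.- μ)
        ≡⟨ solve 1 (λ μ → let μ² = μ :* μ; μ⁶ = μ² :* μ² :* μ² in
             μ :* (μ⁶ :* μ² :* μ :- μ) := (μ² :* μ² :+ con 1ℚ) :* (μ⁶ :- μ²)) refl μ ⟩
      (μ² ℚ.* μ² ℚ.+ 1ℚ) ℚ.* (μ⁶ ℚ.- μ²) ∎)

-- The points P and Q, and why P, Q, P + Q are not halvable.

module _ (k : ℕ) (1<k : 1 ℕ.< k) where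
  private
    m : ℤ
    m = + k
    μ μ² μ⁶ μ⁹ : ℚ
    μ = ι m
    μ² = μ ℚ.* μ
    μ⁶ = μ² ℚ.* μ² ℚ.* μ²
    μ⁹ = μ⁶ ℚ.* μ² ℚ.* μ

    instance
      k≢0 : ℕ.NonZero k
      k≢0 = ℕ.>-nonZero (ℕ.<-trans ℕ.z<s 1<k)

    M = m ℤ.^ 6

  open EllipticCurve (E′ m)
  open GroupLaw (E′ m)
  open E′-Properties m
  open Rank {E′ m} using (Halvable)

  M≡k^6 : M ≡ + (k ^6)
  M≡k^6 = trans (m^6≡m²m²m² m) (sym (trans (ℤ.pos-* (k ℕ.* k ℕ.* (k ℕ.* k)) (k ℕ.* k))
    (cong₂ ℤ._*_ (trans (ℤ.pos-* (k ℕ.* k) (k ℕ.* k)) (cong₂ ℤ._*_ k² k²)) k²)))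
    where k² = ℤ.pos-* k k

  ι-m² : ι (m ℤ.* m) ≡ μ²
  ι-m² = refl {x = μ} ⟨*⟩ refl {x = μ}

  ι-M : ι M ≡ μ⁶
  ι-M = trans (cong ι (m^6≡m²m²m² m)) (ι-m² ⟨*⟩ ι-m² ⟨*⟩ ι-m²)

  M/1≡μ⁶ : M ℚ./ 1 ≡ μ⁶
  M/1≡μ⁶ = trans (/1≡ι M) ι-M

  cubic-no-root : ∀ x → cubic x ≢ 0ℚ
  cubic-no-root x eq = C≢0 k x (subst (λ M → C (↥ x) (↧ x) M ≡ + 0) M≡k^6
    (ι-injective (trans (ι-C x) (trans (cong (Q ℚ.* Q ℚ.* Q ℚ.* Q ℚ.*_) eq)
                                       (ℚ.*-zeroʳ (Q ℚ.* Q ℚ.* Q ℚ.* Q))))))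
    where Q = ι (↧ x)

  P Q : Point
  -- With x = m² the cube cancels m⁶ and leaves y² = m².
  P = affine μ² μ (trans
    (solve 1 (λ μ → let x = μ :* μ; M = x :* x :* x in
       μ :* μ := x :* x :* x :+ con 1ℚ :* x :- M) refl μ)
    (cong (λ M → μ² ℚ.* μ² ℚ.* μ² ℚ.+ 1ℚ ℚ.* μ² ℚ.- M) (sym M/1≡μ⁶)))
    where open ℚ-Solver
  -- With x = m⁶ the linear term cancels m⁶ and leaves y² = m¹⁸.
  Q = affine μ⁶ μ⁹ (trans
    (solve 1 (λ μ → let x₀ = μ :* μ; x = x₀ :* x₀ :* x₀; y = x :* x₀ :* μ in
       y :* y := x :* x :* x :+ con 1ℚ :* x :- x) refl μ)
    (cong (λ M → μ⁶ ℚ.* μ⁶ ℚ.* μ⁶ ℚ.+ 1ℚ ℚ.* μ⁶ ℚ.- M) (sym M/1≡μ⁶)))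
    where open ℚ-Solver

  -- Ensures that `P ⊕ Q` is computed by a chord; it holds because k² < k⁶ for k > 1.
  μ²≢μ⁶ : μ² ≢ μ⁶
  μ²≢μ⁶ eq = ℕ.<-irrefl (ℤ.+-injective (trans (ℤ.pos-* k k) (trans (ι-injective
      (trans ι-m² (trans eq (sym ι-M)))) M≡k^6)))
    (ℕ.<-≤-trans (ℕ.m<m*n (k ℕ.* k) (k ℕ.* k) (ℕ.<-≤-trans 1<k (ℕ.m≤m*n k k)))
                 (ℕ.m≤m*n (k ℕ.* k ℕ.* (k ℕ.* k)) (k ℕ.* k)))
    where instance _ = ℕ.m*n≢0 k k

  P⊕Q-abscissa : ∃ λ X → X ℚ.* μ² ≡ μ² ℚ.* μ² ℚ.+ 1ℚ × HasAbscissa (P ⊕ Q) X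
  P⊕Q-abscissa =
    let s , slope , h = chord-abscissa {μ²} {μ} {μ⁶} {μ⁹} μ²≢μ⁶
    in s ℚ.* s ℚ.- μ² ℚ.- μ⁶ , third-abscissa μ s μ²≢μ⁶ slope , h

  ¬halvable : ∀ {n l M₀} .{{_ : ℕ.NonZero n}} → Obstruction n l M₀ →
              + l Signed.∣ + n → l ≢ 1 → M ≈ M₀ mod (+ n) →
              ∀ c d {R X} → c ≈ + 1 mod (+ n) → d ≈ + 1 mod (+ n) →
              HasAbscissa R X → ι d ℚ.* (4ℚ ℚ.* X) ≡ ι c → ¬ Halvable R
  ¬halvable obstruction l∣n l≢1 M≈M₀ c d c≈1 d≈1 R↦X 4X≡c/d (S , refl) =
    let x , eq = double-abscissa-integral 4X≡c/d S R↦X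
    in no-common-solution obstruction l∣n l≢1 c≈1 d≈1 M≈M₀ x eq

  module _ (3∤m : ¬ (+ 3 ∣ m)) where

    m²≈1 : m ℤ.* m ≈ + 1 mod (+ 3)
    m²≈1 with residue 3 m
    ... | zero           , m≈0 = contradiction
      (Signed.∣⇒∣ᵤ (∣-resp-≈ Signed.∣-refl m≈0 (Signed.divides (+ 0) refl))) 3∤m
    ... | suc zero       , m≈1 = m≈1 [*] m≈1
    ... | suc (suc zero) , m≈2 = ≈-trans (m≈2 [*] m≈2) (congruent (Signed.divides (+ 1) refl))

    M≈1 : M ≈ + 1 mod (+ 3)
    M≈1 = subst (_≈ + 1 mod (+ 3)) (sym (m^6≡m²m²m² m)) (m²≈1 [*] m²≈1 [*] m²≈1)

    ¬halvable-mod-3 : ∀ x {R X} → x ≈ + 1 mod (+ 3) → HasAbscissa R X → ι x ≡ X →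
                      ¬ Halvable R
    ¬halvable-mod-3 x {X = X} x≈1 R↦X ιx≡X =
      -- For an integral abscissa x the fraction for 4X is 4x / 1, and 4 is 1 modulo 3.
      ¬halvable obstruction₃ Signed.∣-refl (λ ()) M≈1 (+ 4 ℤ.* x) (+ 1)
        (congruent {+ 4} {+ 1} (Signed.divides (+ 1) refl) [*] x≈1) ≈-refl R↦X
        (trans (ℚ.*-identityˡ (4ℚ ℚ.* X)) (sym (refl {x = ι (+ 4)} ⟨*⟩ ιx≡X)))

    P-not-halvable : ¬ Halvable P
    P-not-halvable = ¬halvable-mod-3 (m ℤ.* m) m²≈1 hasAbscissa ι-m²

    Q-not-halvable : ¬ Halvable Q
    Q-not-halvable = ¬halvable-mod-3 M M≈1 hasAbscissa ι-M

  module _ (n : ℤ) (m≡n*2 : m ≡ n ℤ.* + 2) (4∤m : ¬ (+ 4 ∣ m)) where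

    n-odd : ¬ (+ 2 Signed.∣ n)
    n-odd (Signed.divides q n≡q*2) = 4∤m (Signed.∣⇒∣ᵤ (Signed.divides q
      (trans m≡n*2 (trans (cong (ℤ._* + 2) n≡q*2) (ℤ.*-assoc q (+ 2) (+ 2))))))

    n²≈1 : n ℤ.* n ≈ + 1 mod (+ 4)
    n²≈1 with residue 4 n
    ... | zero                 , n≈0 = contradiction
      (∣-resp-≈ (Signed.divides (+ 2) refl) n≈0 (Signed.divides (+ 0) refl)) n-odd
    ... | suc zero             , n≈1 = n≈1 [*] n≈1
    ... | suc (suc zero)       , n≈2 = contradiction
      (∣-resp-≈ (Signed.divides (+ 2) refl) n≈2 (Signed.divides (+ 1) refl)) n-odd
    ... | suc (suc (suc zero)) , n≈3 =
      ≈-trans (n≈3 [*] n≈3) (congruent (Signed.divides (+ 2) refl))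

    m²≈0 : m ℤ.* m ≈ + 0 mod (+ 4)
    m²≈0 = congruent (Signed.divides (n ℤ.* n) (trans
      (cong (λ m → m ℤ.* m ℤ.- + 0) m≡n*2)
      (solve 1 (λ n → (n :* con (+ 2)) :* (n :* con (+ 2)) :- con (+ 0)
                      := (n :* n) :* con (+ 4)) refl n)))
      where open ℤ-Solver

    M≈0 : M ≈ + 0 mod (+ 4)
    M≈0 = subst (_≈ + 0 mod (+ 4)) (sym (m^6≡m²m²m² m)) (m²≈0 [*] m²≈0 [*] m²≈0)

    m⁴+1≈1 : m ℤ.* m ℤ.* (m ℤ.* m) ℤ.+ + 1 ≈ + 1 mod (+ 4)
    m⁴+1≈1 = m²≈0 [*] m²≈0 [+] ≈-refl {+ 4} {+ 1}

    P⊕Q-not-halvable : ¬ Halvable (P ⊕ Q)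
    P⊕Q-not-halvable =
      let X , Xμ²≡μ⁴+1 , P⊕Q↦X = P⊕Q-abscissa
      in ¬halvable obstruction₄ (Signed.divides (+ 2) refl) (λ ()) M≈0
           -- As m = 2n, the factor 4 cancels in 4(m⁴ + 1) / m², leaving (m⁴ + 1) / n² with n odd.
           (m ℤ.* m ℤ.* (m ℤ.* m) ℤ.+ + 1) (n ℤ.* n)
           m⁴+1≈1 n²≈1 P⊕Q↦X (begin
             ι (n ℤ.* n) ℚ.* (4ℚ ℚ.* X)
               ≡⟨ cong (ℚ._* (4ℚ ℚ.* X)) (refl {x = ν} ⟨*⟩ refl {x = ν}) ⟩
             (ν ℚ.* ν) ℚ.* (4ℚ ℚ.* X)
               ≡⟨ solve 2 (λ ν X → (ν :* ν) :* (con 4ℚ :* X)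
                            := X :* ((ν :* con 2ℚ) :* (ν :* con 2ℚ))) refl ν X ⟩
             X ℚ.* ((ν ℚ.* 2ℚ) ℚ.* (ν ℚ.* 2ℚ))
               ≡⟨ cong (λ u → X ℚ.* (u ℚ.* u)) μ≡ν*2 ⟨
             X ℚ.* μ²
               ≡⟨ Xμ²≡μ⁴+1 ⟩
             μ² ℚ.* μ² ℚ.+ 1ℚ
               ≡⟨ (ι-m² ⟨*⟩ ι-m² ⟨+⟩ refl {x = 1ℚ}) ⟨
             ι (m ℤ.* m ℤ.* (m ℤ.* m) ℤ.+ + 1) ∎)
      where
      open ≡-Reasoning
      open ℚ-Solver
      ν = ι n
      μ≡ν*2 : μ ≡ ν ℚ.* 2ℚ
      μ≡ν*2 = trans (cong ι m≡n*2) (refl {x = ν} ⟨*⟩ refl {x = 2ℚ})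

theorem1p3 : (m : ℤ) → + 1 < m → ¬ (+ 3 ∣ m) → + 2 ∣ m → ¬ (+ 4 ∣ m) →
    (r : ℕ) → HasRank (E′ m) r → 2 ≤ r
theorem1p3 (+ k) (ℤ.+<+ 1<k) 3∤m 2∣m 4∤m r rank =
  Rank.2≤rank rank
    (Abscissae.no-root⇒no-2-torsion (E′ (+ k)) (cubic-no-root k 1<k))
    (P k 1<k) (Q k 1<k)
    (P-not-halvable k 1<k 3∤m) (Q-not-halvable k 1<k 3∤m)
    (P⊕Q-not-halvable k 1<k (Signed.quotient 2∣ˢm) (Signed._∣_.equality 2∣ˢm) 4∤m)
  where
  2∣ˢm : + 2 Signed.∣ + k
  2∣ˢm = Signed.∣ᵤ⇒∣ 2∣m
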